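{- Let $s$ and $L$ be positive integers with $L \ge s+1$. Then the coefficient of $q^n$ in $G_{L,s}(q)$ is positive for every integer $n \ge \delta'(s)$. In particular $G_{L,s}(q)$ is eventually positive.
   Context: A partition $\pi$ is a finite weakly decreasing sequence of positive integers; $|\pi|$ is the sum of its parts, $s(\pi)$ its smallest part and $l(\pi)$ its largest part. For positive integers $L,s$, $$G_{L,s}(q) := \sum_{\substack{\pi \text{ nonempty},\ s(\pi)=s,\\ l(\pi)-s(\pi)\le L}} q^{|\pi|} \;-\; \sum_{\substack{\pi \text{ nonempty},\ s(\pi)\ge s+1,\\ l(\pi)-s(\pi)\le L}} q^{|\pi|}.$$ A series $\sum_n a_n q^n$ is eventually positive if there is $l$ with $a_n>0$ for all $n \ge l$. Define, for positive integers $L,s$: $P_{L,s} = (s+1)(s+2)\cdots(s+L)$, $$\gamma(L,s) = \big((s+1)+(s+2)+\cdots+(s+L)\big)\cdot\Big(P_{L,s}^{(P_{L,s}^2-1)L+2} + \big((P_{L,s}^2-1)L-2\big)P_{L,s}\Big),$$ $\Gamma(s) = \gamma(3s+2,s)$, $\delta(s) = e^{3\Gamma(s)}$, and $\delta'(s) = 10s + (s+2)(s+3)(\delta(s)+1)$. -}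

module Defs where

open import Data.Nat using (ℕ; zero; suc; _+_; _*_; _∸_; _^_; _≤_; _<_; _≥_; _!)
open import Data.List using (List; []; _∷_)
open import Data.Nat.ListAction using (sum)
open import Relation.Binary.PropositionalEquality using (_≡_)
open import Data.Empty using (⊥)
open import Data.Unit using (⊤)
open import Data.List.Relation.Unary.All using (All)
open import Data.List.Relation.Unary.Linked using (Linked)
open import Data.Product using (_×_)

IsPartition : ℕ → List ℕ → Set
IsPartition n π = Linked _≥_ π × All (λ x → 0 < x) π × sum π ≡ n

-- largest part (head of a weakly decreasing list); only used on nonempty lists
largest : List ℕ → ℕ
largest []      = 0
largest (x ∷ _) = x

-- smallest part (last element of a weakly decreasing list); only used on nonempty lists
smallest : List ℕ → ℕ
smallest []          = 0
smallest (x ∷ [])    = x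
smallest (_ ∷ y ∷ ys) = smallest (y ∷ ys)

NonEmpty : List ℕ → Set
NonEmpty []      = ⊥
NonEmpty (_ ∷ _) = ⊤

-- partitions counted positively in the coefficient of q^n of G_{L,s}
PosPart : ℕ → ℕ → ℕ → List ℕ → Set
PosPart L s n π = IsPartition n π × NonEmpty π × smallest π ≡ s × largest π ∸ smallest π ≤ L

-- partitions counted negatively in the coefficient of q^n of G_{L,s}
NegPart : ℕ → ℕ → ℕ → List ℕ → Set
NegPart L s n π = IsPartition n π × NonEmpty π × suc s ≤ smallest π × largest π ∸ smallest π ≤ L

sumShift : ℕ → ℕ → ℕ
sumShift zero    s = 0
sumShift (suc L) s = sumShift L s + (s + suc L)

prodShift : ℕ → ℕ → ℕ
prodShift zero    s = 1
prodShift (suc L) s = prodShift L s * (s + suc L)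

-- γ(L,s); note (P^2-1)L - 2 ≥ 1 for L,s ≥ 1 (P ≥ 2), so truncated ∸ is harmless
γ : ℕ → ℕ → ℕ
γ L s = sumShift L s * (P ^ (((P * P) ∸ 1) * L + 2) + ((((P * P) ∸ 1) * L) ∸ 2) * P)
  where P = prodShift L s

Γ : ℕ → ℕ
Γ s = γ (3 * s + 2) s

-- expNum y K = K! * Σ_{k=0}^{K} y^k / k!   (a natural number), by the recursion
-- expNum y 0 = 1,  expNum y (K+1) = (K+1) * expNum y K + y^(K+1).
expNum : ℕ → ℕ → ℕ
expNum y zero    = 1
expNum y (suc K) = suc K * expNum y K + y ^ suc K

-- n ≥ δ'(s) = 10s + (s+2)(s+3)(e^{3Γ(s)} + 1), as a real inequality.
-- Since e^y is the supremum of the increasing partial sums Σ_{k≤K} y^k/k!,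
-- this holds iff for every K:  K!·n ≥ K!·(10s + c) + c·expNum (3Γ(s)) K,  c = (s+2)(s+3).
AboveDelta' : ℕ → ℕ → Set
AboveDelta' s n = ∀ K → (K !) * (10 * s + c) + c * expNum (3 * Γ s) K ≤ (K !) * n
  where c = (s + 2) * (s + 3)

{-# OPTIONS --safe #-}

-- Let p(n) count the partitions of n into parts from s + 1, …, s + L.
-- Positive partitions are counted by Σ_{i ≥ 1} p(n − is), and negative ones, by
-- telescoping over the smallest part, by at most Σ_{j ≥ 0} p(n − jL).  As p is
-- monotone under steps larger than s, the term j is dominated by the term
-- i = j + 2 once j > 3s, which leaves 3s + 2 positive terms against 3s + 1
-- negative ones.  It remains to see that p(n − D) / p(n) is close to 1,
-- uniformly in L.  Equivalently, few partitions avoid the part s + 1.  A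
-- partition avoiding s + 1 and s + 2 contains either a large part or many
-- copies of one small part; either can be traded for copies of s + 1 and s + 2
-- in many ways.  Among those with parts s + 2, many copies can be traded for
-- parts s + 1.

module Submission where

open import Defs
open import Data.Nat
open import Data.Nat.Properties
open import Data.Nat.DivMod using (_/_; _%_; m≡m%n+[m/n]*n; m%n<n; /-mono-≤; m*n/n≡m)
open import Data.Nat.Induction using (<-rec)
open import Data.Nat.ListAction using (sum)
open import Data.Nat.Tactic.RingSolver using (solve-∀)
open import Data.Empty using (⊥)
open import Data.List using (List; []; _∷_; _++_; map; length)
open import Data.List.Properties using (length-++; length-map; ∷-injectiveʳ)
open import Data.List.Membership.Propositional using (_∈_)
open import Data.List.Membership.Propositional.Properties
  using (∈-++⁺ˡ; ∈-++⁺ʳ; ∈-++⁻; ∈-map⁺; ∈-map⁻; ∈-∃++)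
open import Data.List.Relation.Unary.All as All using (All; []; _∷_)
import Data.List.Relation.Unary.All.Properties as All
open import Data.List.Relation.Unary.AllPairs using ([]; _∷_)
open import Data.List.Relation.Unary.Any using (here; there)
open import Data.List.Relation.Unary.Linked using (Linked; []; [-]; _∷_)
open import Data.List.Relation.Unary.Unique.Propositional using (Unique)
import Data.List.Relation.Unary.Unique.Propositional.Properties as Unique
open import Data.Product using (_×_; _,_; proj₁; proj₂; ∃-syntax)
open import Data.Sum using (inj₁; inj₂)
open import Data.Unit using (tt)
open import Function using (_∘_; _⇔_; Equivalence)
open import Relation.Binary.PropositionalEquality
  using (_≡_; refl; sym; trans; cong; cong₂; subst; module ≡-Reasoning)
open import Relation.Nullary using (yes; no; contradiction)

-- Shifted sequences and recursion on the index.

shift : {A : Set} → A → ℕ → (ℕ → A) → ℕ → A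
shift d zero    f n       = f n
shift d (suc x) f zero    = d
shift d (suc x) f (suc n) = shift d x f n

shift-at : ∀ {A : Set} (d : A) x f n → shift d x f (x + n) ≡ f n
shift-at d zero    f n = refl
shift-at d (suc x) f n = shift-at d x f n

module _ {A B : Set} (R : A → B → Set) {d : A} {d′ : B} where

  -- The hypothesis is asked only at the index `m` actually reached, so an induction hypothesis
  -- known at smaller indices can be supplied. Taking `B` to be the unit type gives the version for
  -- predicates.
  shift-rel : R d d′ → ∀ x {f : ℕ → A} {g : ℕ → B} n →
    (∀ m → m + x ≡ n → R (f m) (g m)) → R (shift d x f n) (shift d′ x g n)
  shift-rel r zero    n       h = h n (+-identityʳ n)
  shift-rel r (suc x) zero    h = r
  shift-rel r (suc x) (suc n) h =
    shift-rel r x n (λ m e → h m (trans (+-suc m x) (cong suc e)))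

below : ∀ {m x n} → m + suc x ≡ n → m < n
below {m} {x} refl = m<m+n m z<s

-- The unique solution h of h n = op (h (n − (x + 1))) (f n), a value at a
-- negative index being d.
module Recursion {A : Set} (op : A → A → A) (d : A) (x : ℕ) (f : ℕ → A) where

  -- `k` is fuel: each recursive call lowers the index by at least 1, so the value is the intended
  -- one as soon as `n ≤ k`.
  approx : ℕ → ℕ → A
  approx zero    n = op d (f n)
  approx (suc k) n = op (shift d (suc x) (approx k) n) (f n)

  approx-stable : ∀ k l n → n ≤ k → n ≤ l → approx k n ≡ approx l n
  approx-stable zero    zero    n p   q   = refl
  approx-stable zero    (suc l) _ z≤n q   = refl
  approx-stable (suc k) zero    _ p   z≤n = refl
  approx-stable (suc k) (suc l) n p   q   =
    cong (λ a → op a (f n)) (shift-rel _≡_ refl (suc x) n λ m e →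
      approx-stable k l m (s≤s⁻¹ (≤-trans (below e) p)) (s≤s⁻¹ (≤-trans (below e) q)))

  solution : ℕ → A
  solution n = approx n n

  unfold : ∀ n → solution n ≡ op (shift d (suc x) solution n) (f n)
  unfold zero    = refl
  unfold (suc n) = cong (λ a → op a (f (suc n))) (shift-rel _≡_ refl (suc x) (suc n) λ m e →
    approx-stable n m m (s≤s⁻¹ (below e)) ≤-refl)

open Recursion using (solution; unfold)

-- Power series: shifts and geometric series.

sh : ℕ → (ℕ → ℕ) → ℕ → ℕ
sh = shift 0

sh-cong : ∀ x {f g} → (∀ n → f n ≡ g n) → ∀ n → sh x f n ≡ sh x g n
sh-cong x e n = shift-rel _≡_ refl x n (λ m _ → e m)

sh-mono : ∀ x {f g} → (∀ n → f n ≤ g n) → ∀ n → sh x f n ≤ sh x g n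
sh-mono x e n = shift-rel _≤_ ≤-refl x n (λ m _ → e m)

sh-sh : ∀ x y f n → sh x (sh y f) n ≡ sh (x + y) f n
sh-sh zero    y f n       = refl
sh-sh (suc x) y f zero    = refl
sh-sh (suc x) y f (suc n) = sh-sh x y f n

sh-comm : ∀ x y f n → sh x (sh y f) n ≡ sh y (sh x f) n
sh-comm x y f n = trans (sh-sh x y f n)
  (trans (cong (λ z → sh z f n) (+-comm x y)) (sym (sh-sh y x f n)))

sh-+ : ∀ x f g n → sh x (λ m → f m + g m) n ≡ sh x f n + sh x g n
sh-+ zero    f g n       = refl
sh-+ (suc x) f g zero    = refl
sh-+ (suc x) f g (suc n) = sh-+ x f g n

sh-* : ∀ x c f n → sh x (λ m → c * f m) n ≡ c * sh x f n
sh-* zero    c f n       = refl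
sh-* (suc x) c f zero    = sym (*-zeroʳ c)
sh-* (suc x) c f (suc n) = sh-* x c f n

sh-0 : ∀ x n → sh x (λ _ → 0) n ≡ 0
sh-0 zero    n       = refl
sh-0 (suc x) zero    = refl
sh-0 (suc x) (suc n) = sh-0 x n

-- A power series is its coefficient function; geom x f is f / (1 − q^(x + 1)),
-- the shifted index keeping the recursion well founded for every x.
geom : ℕ → (ℕ → ℕ) → ℕ → ℕ
geom = solution _+_ 0

geom-unfold : ∀ x f n → geom x f n ≡ sh (suc x) (geom x f) n + f n
geom-unfold = unfold _+_ 0

-- A comparison principle: the recursion is monotone in earlier values, so a subsolution stays below
-- the solution.
geom-≤ : ∀ x {f h} → (∀ n → h n ≤ sh (suc x) h n + f n) → ∀ n → h n ≤ geom x f n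
geom-≤ x {f} {h} step = <-rec _ λ n ih → ≤-trans (step n)
  (≤-trans (+-monoˡ-≤ (f n) (shift-rel _≤_ ≤-refl (suc x) n (λ m e → ih (below e))))
    (≤-reflexive (sym (geom-unfold x f n))))

geom-≥ : ∀ x {f h} → (∀ n → sh (suc x) h n + f n ≤ h n) → ∀ n → geom x f n ≤ h n
geom-≥ x {f} {h} step = <-rec _ λ n ih → ≤-trans (≤-reflexive (geom-unfold x f n))
  (≤-trans (+-monoˡ-≤ (f n) (shift-rel _≤_ ≤-refl (suc x) n (λ m e → ih (below e)))) (step n))

geom-unique : ∀ x {f h} → (∀ n → h n ≡ sh (suc x) h n + f n) → ∀ n → h n ≡ geom x f n
geom-unique x e n = ≤-antisym (geom-≤ x (λ m → ≤-reflexive (e m)) n)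
                              (geom-≥ x (λ m → ≤-reflexive (sym (e m))) n)

geom-mono : ∀ x {f g} → (∀ n → f n ≤ g n) → ∀ n → geom x f n ≤ geom x g n
geom-mono x {f} e = geom-≤ x λ n → ≤-trans (≤-reflexive (geom-unfold x f n)) (+-monoʳ-≤ _ (e n))

geom-cong : ∀ x {f g} → (∀ n → f n ≡ g n) → ∀ n → geom x f n ≡ geom x g n
geom-cong x {f} e = geom-unique x λ n → trans (geom-unfold x f n) (cong (_ +_) (e n))

geom-step : ∀ x f n → sh (suc x) (geom x f) n ≤ geom x f n
geom-step x f n = ≤-trans (m≤m+n _ (f n)) (≤-reflexive (sym (geom-unfold x f n)))

geom-incl : ∀ x f n → f n ≤ geom x f n
geom-incl x f n = ≤-trans (m≤n+m (f n) _) (≤-reflexive (sym (geom-unfold x f n)))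

geom-sh : ∀ x y f n → geom x (sh y f) n ≡ sh y (geom x f) n
geom-sh x y f n = sym (geom-unique x (λ m → begin
  sh y (geom x f) m                            ≡⟨ sh-cong y (geom-unfold x f) m ⟩
  sh y (λ k → sh (suc x) (geom x f) k + f k) m ≡⟨ sh-+ y _ f m ⟩
  sh y (sh (suc x) (geom x f)) m + sh y f m    ≡⟨ cong (_+ _) (sh-comm y (suc x) _ m) ⟩
  sh (suc x) (sh y (geom x f)) m + sh y f m    ∎) n)
  where open ≡-Reasoning

geom-comm : ∀ x y f n → geom x (geom y f) n ≡ geom y (geom x f) n
geom-comm x y f n = ≤-antisym (half x y n) (half y x n)
  where
  open ≡-Reasoning
  half : ∀ x y n → geom x (geom y f) n ≤ geom y (geom x f) n
  -- The inner comparison bounds `h` by `sh Y h + geom x f`, which satisfies the recursion of `h`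
  -- with equality.
  half x y = geom-≤ y λ n → geom-≥ x (λ m → ≤-reflexive (eq m)) n
    where
    h = geom x (geom y f)
    X = suc x
    Y = suc y
    swap : ∀ a b c d → a + b + (c + d) ≡ a + c + (b + d)
    swap = solve-∀
    eq : ∀ m → sh X (λ k → sh Y h k + geom x f k) m + geom y f m ≡ sh Y h m + geom x f m
    eq m = begin
      sh X (λ k → sh Y h k + geom x f k) m + geom y f m
        ≡⟨ cong₂ _+_ (sh-+ X _ _ m) (geom-unfold y f m) ⟩
      sh X (sh Y h) m + sh X (geom x f) m + (sh Y (geom y f) m + f m)
        ≡⟨ swap (sh X (sh Y h) m) _ _ _ ⟩
      sh X (sh Y h) m + sh Y (geom y f) m + (sh X (geom x f) m + f m)
        ≡⟨ cong₂ _+_ (cong (_+ _) (sh-comm X Y h m)) (sym (geom-unfold x f m)) ⟩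
      sh Y (sh X h) m + sh Y (geom y f) m + geom x f m
        ≡⟨ cong (_+ _) (sym (sh-+ Y _ _ m)) ⟩
      sh Y (λ k → sh X h k + geom y f k) m + geom x f m
        ≡⟨ cong (_+ _) (sh-cong Y (λ k → sym (geom-unfold x (geom y f) k)) m) ⟩
      sh Y h m + geom x f m ∎

-- Finite sums.

Σ : ℕ → (ℕ → ℕ) → ℕ
Σ zero    f = 0
Σ (suc k) f = Σ k f + f k

Σ-mono : ∀ k {f g : ℕ → ℕ} → (∀ i → i < k → f i ≤ g i) → Σ k f ≤ Σ k g
Σ-mono zero    h = z≤n
Σ-mono (suc k) h = +-mono-≤ (Σ-mono k (λ i p → h i (m<n⇒m<1+n p))) (h k ≤-refl)

Σ-≤const : ∀ k {f c} → (∀ i → i < k → f i ≤ c) → Σ k f ≤ k * c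
Σ-≤const zero    h = z≤n
Σ-≤const (suc k) {f} {c} h = ≤-trans (+-mono-≤ (Σ-≤const k (λ i p → h i (m<n⇒m<1+n p))) (h k ≤-refl))
  (≤-reflexive (+-comm (k * c) c))

Σ-≥const : ∀ k {f c} → (∀ i → i < k → c ≤ f i) → k * c ≤ Σ k f
Σ-≥const zero    h = z≤n
Σ-≥const (suc k) {f} {c} h = ≤-trans (≤-reflexive (+-comm c (k * c)))
  (+-mono-≤ (Σ-≥const k (λ i p → h i (m<n⇒m<1+n p))) (h k ≤-refl))

Σ-cong : ∀ k {f g : ℕ → ℕ} → (∀ i → i < k → f i ≡ g i) → Σ k f ≡ Σ k g
Σ-cong k h = ≤-antisym (Σ-mono k (λ i p → ≤-reflexive (h i p)))
                       (Σ-mono k (λ i p → ≤-reflexive (sym (h i p))))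

Σ-* : ∀ k c f → Σ k (λ i → c * f i) ≡ c * Σ k f
Σ-* zero    c f = sym (*-zeroʳ c)
Σ-* (suc k) c f = trans (cong (_+ c * f k) (Σ-* k c f)) (sym (*-distribˡ-+ c _ _))

Σ-+ : ∀ k f g → Σ k (λ i → f i + g i) ≡ Σ k f + Σ k g
Σ-+ zero    f g = refl
Σ-+ (suc k) f g = trans (cong (_+ (f k + g k)) (Σ-+ k f g)) (lem (Σ k f) _ _ _)
  where
  lem : ∀ a b c d → a + b + (c + d) ≡ a + c + (b + d)
  lem = solve-∀

Σ-split : ∀ j k f → Σ (k + j) f ≡ Σ j f + Σ k (λ i → f (i + j))
Σ-split j zero    f = sym (+-identityʳ _)
Σ-split j (suc k) f = trans (cong (_+ f (k + j)) (Σ-split j k f)) (+-assoc (Σ j f) _ _)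

Σ-term : ∀ k f i → i < k → f i ≤ Σ k f
Σ-term (suc k) f i i<k with m≤n⇒m<n∨m≡n (s≤s⁻¹ i<k)
... | inj₁ p    = ≤-trans (Σ-term k f i p) (m≤m+n _ _)
... | inj₂ refl = m≤n+m (f i) _

Σ-sh : ∀ k x (f : ℕ → ℕ → ℕ) n → Σ k (λ i → sh x (f i) n) ≡ sh x (λ m → Σ k (λ i → f i m)) n
Σ-sh zero    x f n = sym (sh-0 x n)
Σ-sh (suc k) x f n = trans (cong (_+ sh x (f k) n) (Σ-sh k x f n)) (sym (sh-+ x _ (f k) n))

-- Each of the `d` terms is at most `P / (d K)`, so the sum is at most `P / K`. Union bounds are
-- finished this way.
Σ-average : ∀ d K f {P} → (∀ i → i < d → d * K * f i ≤ P) → K * Σ d f ≤ P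
Σ-average zero      K f h = ≤-trans (≤-reflexive (*-zeroʳ K)) z≤n
Σ-average d@(suc _) K f {P} h = *-cancelˡ-≤ d (begin
  d * (K * Σ d f)            ≡⟨ *-assoc d K _ ⟨
  d * K * Σ d f              ≡⟨ Σ-* d (d * K) f ⟨
  Σ d (λ i → d * K * f i)    ≤⟨ Σ-≤const d h ⟩
  d * P                      ∎)
  where open ≤-Reasoning

-- Partitions are split by the number of parts `x + 1`: exactly `k < M`, or at least `M`.
geom-iterate : ∀ x f M n →
  geom x f n ≡ Σ M (λ k → sh (k * suc x) f n) + sh (M * suc x) (geom x f) n
geom-iterate x f zero    n = refl
geom-iterate x f (suc M) n = begin
  geom x f n
    ≡⟨ geom-iterate x f M n ⟩
  S + sh (M * X) (geom x f) n
    ≡⟨ cong (S +_) (sh-cong (M * X) (geom-unfold x f) n) ⟩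
  S + sh (M * X) (λ k → sh X (geom x f) k + f k) n
    ≡⟨ cong (S +_) (sh-+ (M * X) _ _ n) ⟩
  S + (sh (M * X) (sh X (geom x f)) n + sh (M * X) f n)
    ≡⟨ cong (λ z → S + (z + sh (M * X) f n)) (trans (sh-comm (M * X) X _ n) (sh-sh X (M * X) _ n)) ⟩
  S + (sh (X + M * X) (geom x f) n + sh (M * X) f n)
    ≡⟨ lem S _ _ ⟩
  S + sh (M * X) f n + sh (X + M * X) (geom x f) n ∎
  where
  open ≡-Reasoning
  X = suc x
  S = Σ M (λ k → sh (k * suc x) f n)
  lem : ∀ a b c → a + (b + c) ≡ a + c + b
  lem = solve-∀

geom-Σ : ∀ x f M n → Σ M (λ k → sh (k * suc x) f n) ≤ geom x f n
geom-Σ x f M n = ≤-trans (m≤m+n _ _) (≤-reflexive (sym (geom-iterate x f M n)))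

sh-beyond : ∀ x f n → n < x → sh x f n ≡ 0
sh-beyond (suc x) f zero    p = refl
sh-beyond (suc x) f (suc n) p = sh-beyond x f n (s<s⁻¹ p)

geom-Σ-full : ∀ x f M n → n < M → geom x f n ≡ Σ M (λ k → sh (k * suc x) f n)
geom-Σ-full x f M n p = trans (geom-iterate x f M n)
  (trans (cong (Σ M (λ k → sh (k * suc x) f n) +_)
    (sh-beyond (M * suc x) _ n (≤-trans p (m≤m*n M (suc x))))) (+-identityʳ _))

-- Products of geometric series and partition counts.

-- f / ((1 − q^(m + 1)) ⋯ (1 − q^(m + k))).
seg : ℕ → ℕ → (ℕ → ℕ) → ℕ → ℕ
seg m zero    f = f
seg m (suc k) f = geom (m + k) (seg m k f)

seg-sh : ∀ m k y f n → seg m k (sh y f) n ≡ sh y (seg m k f) n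
seg-sh m zero    y f n = refl
seg-sh m (suc k) y f n = trans (geom-cong (m + k) (seg-sh m k y f) n) (geom-sh (m + k) y _ n)

seg-front : ∀ m k f n → seg m (suc k) f n ≡ geom m (seg (suc m) k f) n
seg-front m zero    f n = cong (λ x → geom x f n) (+-identityʳ m)
seg-front m (suc k) f n = begin
  geom (m + suc k) (seg m (suc k) f) n            ≡⟨ geom-cong (m + suc k) (seg-front m k f) n ⟩
  geom (m + suc k) (geom m (seg (suc m) k f)) n   ≡⟨ geom-comm (m + suc k) m _ n ⟩
  geom m (geom (m + suc k) (seg (suc m) k f)) n
    ≡⟨ cong (λ x → geom m (geom x (seg (suc m) k f)) n) (+-suc m k) ⟩
  geom m (geom (suc m + k) (seg (suc m) k f)) n   ∎
  where open ≡-Reasoning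

seg-step : ∀ m k f i → i < k → ∀ n → sh (suc (m + i)) (seg m k f) n ≤ seg m k f n
seg-step m (suc k) f i i<k n with m≤n⇒m<n∨m≡n (s≤s⁻¹ i<k)
... | inj₂ refl = geom-step (m + i) _ n
... | inj₁ p    = ≤-trans (≤-reflexive (sym (geom-sh (m + k) (suc (m + i)) _ n)))
                          (geom-mono (m + k) (seg-step m k f i p) n)

seg-incl : ∀ m j k f n → seg m k f n ≤ seg m (j + k) f n
seg-incl m zero    k f n = ≤-refl
seg-incl m (suc j) k f n = ≤-trans (seg-incl m j k f n) (geom-incl (m + (j + k)) _ n)

-- The power series 1, so that `seg m k δ` counts partitions into parts from m + 1 to m + k. It is
-- unrelated to the δ(s) of the theorem.
δ : ℕ → ℕ
δ zero    = 1
δ (suc n) = 0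

Σ-front : ∀ k f → Σ (suc k) f ≡ f 0 + Σ k (f ∘ suc)
Σ-front k f = trans (trans (cong (λ j → Σ j f) (+-comm 1 k)) (Σ-split 1 k f))
  (cong (f 0 +_) (Σ-cong k (λ i _ → cong f (+-comm i 1))))

geom-step-preserved : ∀ x y {f} → (∀ n → sh y f n ≤ f n) → ∀ n → sh y (geom x f) n ≤ geom x f n
geom-step-preserved x y {f} h n =
  ≤-trans (≤-reflexive (sym (geom-sh x y f n))) (geom-mono x h n)

sh-multiple : ∀ x {f} → (∀ n → sh x f n ≤ f n) → ∀ j n → sh (j * x) f n ≤ f n
sh-multiple x     h zero    n = ≤-refl
sh-multiple x {f} h (suc j) n = ≤-trans (≤-reflexive (sym (sh-sh x (j * x) f n)))
  (≤-trans (sh-mono x (sh-multiple x h j) n) (h n))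

-- A step `t` with s < t ≤ 2s + 1 is itself an available part, because `s < L`. From a longer step
-- one part s + 1 is peeled off, and the remainder still exceeds `s`.
seg-gap : ∀ s L f → s < L → ∀ t → s < t → ∀ n → sh t (seg s L f) n ≤ seg s L f n
seg-gap s L f s<L = <-rec _ go
  where
  go : ∀ t → (∀ {r} → r < t → s < r → ∀ n → sh r (seg s L f) n ≤ seg s L f n) →
       s < t → ∀ n → sh t (seg s L f) n ≤ seg s L f n
  go t ih s<t n with m≤n⇒∃[o]m+o≡n s<t
  ... | r , refl with r ≤? s
  ...   | yes r≤s = seg-step s L f r (≤-<-trans r≤s s<L) n
  ...   | no  r≰s = begin
    sh (suc s + r) (seg s L f) n      ≡⟨ sh-sh (suc s) r _ n ⟨
    sh (suc s) (sh r (seg s L f)) n   ≤⟨ sh-mono (suc s) (ih (m<n+m r z<s) (≰⇒> r≰s)) n ⟩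
    sh (suc s) (seg s L f) n          ≡⟨ cong (λ x → sh (suc x) (seg s L f) n) (+-identityʳ s) ⟨
    sh (suc (s + 0)) (seg s L f) n    ≤⟨ seg-step s L f 0 (≤-<-trans z≤n s<L) n ⟩
    seg s L f n                       ∎
    where open ≤-Reasoning

seg-anti : ∀ s L f → s < L → ∀ x y → x + suc s ≤ y → ∀ n → sh y (seg s L f) n ≤ sh x (seg s L f) n
seg-anti s L f s<L x y le n with m≤n⇒∃[o]m+o≡n le
... | r , refl = begin
  sh (x + suc s + r) h n     ≡⟨ cong (λ z → sh z h n) (+-assoc x (suc s) r) ⟩
  sh (x + (suc s + r)) h n   ≡⟨ sh-sh x (suc s + r) h n ⟨
  sh x (sh (suc s + r) h) n  ≤⟨ sh-mono x (seg-gap s L f s<L (suc s + r) (m≤m+n (suc s) r)) n ⟩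
  sh x h n                   ∎
  where
  open ≤-Reasoning
  h = seg s L f

seg-pos : ∀ s L → s < L → ∀ n → s < n → 0 < seg s L δ n
seg-pos s L s<L n s<n = begin
  1                      ≤⟨ subst (λ j → 1 ≤ seg s j δ 0) (+-identityʳ L) (seg-incl s L 0 δ 0) ⟩
  seg s L δ 0            ≡⟨ shift-at 0 n _ 0 ⟨
  sh n (seg s L δ) (n + 0) ≡⟨ cong (sh n (seg s L δ)) (+-identityʳ n) ⟩
  sh n (seg s L δ) n     ≤⟨ seg-gap s L δ s<L n s<n n ⟩
  seg s L δ n            ∎
  where open ≤-Reasoning

-- Trading a total for parts s + 1 and s + 2.

-- reps s t counts the ways to write t with parts s + 1 and s + 2.
reps : ℕ → ℕ → ℕ
reps s = geom s (geom (suc s) δ)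

geom-δ-multiple : ∀ x k → 1 ≤ geom x δ (k * suc x)
geom-δ-multiple x zero    = ≤-refl
geom-δ-multiple x (suc k) = begin
  1                                              ≤⟨ geom-δ-multiple x k ⟩
  geom x δ (k * suc x)                           ≡⟨ shift-at 0 (suc x) (geom x δ) (k * suc x) ⟨
  sh (suc x) (geom x δ) (suc x + k * suc x)      ≤⟨ geom-step x δ (suc x + k * suc x) ⟩
  geom x δ (suc x + k * suc x)                   ∎
  where open ≤-Reasoning

-- Since b ≡ 1 modulo a, among the ways to write `t ≥ a b` there is one with fewer than `a` copies
-- of `b`. Setting aside `a` copies of `b` and repeating gives one new way for each `a b` contained
-- in `t`.
reps-≥ : ∀ s K t → K * (suc s * suc (suc s)) ≤ t → K ≤ reps s t
reps-≥ s K t le = ≤-trans (go K t le) (≤-reflexive (geom-comm (suc s) s δ t))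
  where
  open ≤-Reasoning
  a = suc s
  b = suc a
  w = geom s δ
  u = geom a w
  write : ∀ t → a * b ≤ t → 1 ≤ Σ a (λ j → sh (j * b) w t)
  -- With `r = t % a` copies of `b` there remain `q = t / a - r` copies of `a`; `q` exists because
  -- `r < a < b ≤ t / a`.
  write t ab≤t with m≤n⇒∃[o]m+o≡n (begin
    t % a      ≤⟨ <⇒≤ (m%n<n t a) ⟩
    a          ≤⟨ n≤1+n a ⟩
    b          ≡⟨ m*n/n≡m b a ⟨
    b * a / a  ≡⟨ cong (_/ a) (*-comm b a) ⟩
    a * b / a  ≤⟨ /-mono-≤ ab≤t (≤-refl {a}) ⟩
    t / a      ∎)
  ... | q , eq = begin
    1                                ≤⟨ geom-δ-multiple s q ⟩
    w (q * a)                        ≡⟨ shift-at 0 (t % a * b) w (q * a) ⟨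
    sh (t % a * b) w (t % a * b + q * a) ≡⟨ cong (sh (t % a * b) w) t-eq ⟨
    sh (t % a * b) w t               ≤⟨ Σ-term a (λ j → sh (j * b) w t) (t % a) (m%n<n t a) ⟩
    Σ a (λ j → sh (j * b) w t)       ∎
    where
    lem : ∀ r q s → r + (r + q) * (1 + s) ≡ r * (2 + s) + q * (1 + s)
    lem = solve-∀
    t-eq : t ≡ t % a * b + q * a
    t-eq = trans (m≡m%n+[m/n]*n t a)
      (trans (cong (λ z → t % a + z * a) (sym eq)) (lem (t % a) q s))
  go : ∀ K t → K * (a * b) ≤ t → K ≤ u t
  go zero    t le = z≤n
  go (suc K) t le with m≤n⇒∃[o]m+o≡n (≤-trans (m≤m+n (a * b) (K * (a * b))) le)
  ... | t′ , refl = begin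
    1 + K
      ≤⟨ +-mono-≤ (write t le′) (go K t′ (+-cancelˡ-≤ (a * b) _ _ le)) ⟩
    Σ a (λ j → sh (j * b) w t) + u t′
      ≡⟨ cong (Σ a (λ j → sh (j * b) w t) +_) (shift-at 0 (a * b) u t′) ⟨
    Σ a (λ j → sh (j * b) w t) + sh (a * b) u t
      ≡⟨ geom-iterate a w a t ⟨
    u t                                                      ∎
    where le′ = m≤m+n (a * b) t′

-- The product of the series `v` and `g` is at most `f` in every coefficient, the convolution being
-- replaced by finite sums of any length.
Dominates : (ℕ → ℕ) → (ℕ → ℕ) → (ℕ → ℕ) → Set
Dominates f v g = ∀ N n → Σ N (λ t → v t * sh t g n) ≤ f n

δ-dominated : ∀ g → Dominates g δ g
δ-dominated g zero          n = z≤n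
δ-dominated g (suc zero)    n = ≤-reflexive (+-identityʳ (g n))
δ-dominated g (suc (suc N)) n = ≤-trans (≤-reflexive (+-identityʳ _)) (δ-dominated g (suc N) n)

Σ-reindex : ∀ x w (h : ℕ → ℕ) N → Σ N (λ t → sh x w t * h t) ≤ Σ N (λ t → w t * h (x + t))
Σ-reindex zero    w h N       = ≤-refl
Σ-reindex (suc x) w h zero    = z≤n
Σ-reindex (suc x) w h (suc N) = begin
  Σ (suc N) (λ t → sh (suc x) w t * h t)   ≡⟨ Σ-front N (λ t → sh (suc x) w t * h t) ⟩
  Σ N (λ t → sh x w t * h (suc t))         ≤⟨ Σ-reindex x w (h ∘ suc) N ⟩
  Σ N (λ t → w t * h (suc (x + t)))        ≤⟨ m≤m+n _ _ ⟩
  Σ (suc N) (λ t → w t * h (suc x + t))    ∎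
  where open ≤-Reasoning

-- Both sides are multiplied by the same geometric series: the convolution with `geom x v` is a
-- subsolution of the recursion of `geom x f`.
geom-dominates : ∀ x {f v g} → Dominates f v g → Dominates (geom x f) (geom x v) g
geom-dominates x {f} {v} {g} dom N = <-rec _ go
  where
  open ≤-Reasoning
  X = suc x
  w = geom x v
  conv : (ℕ → ℕ) → ℕ → ℕ
  conv w n = Σ N (λ t → w t * sh t g n)
  go : ∀ n → (∀ {m} → m < n → conv w m ≤ geom x f m) → conv w n ≤ geom x f n
  go n ih = begin
    conv w n
      ≡⟨ Σ-cong N (λ t _ → trans (cong (_* sh t g n) (geom-unfold x v t))
                                 (*-distribʳ-+ (sh t g n) (sh X w t) (v t))) ⟩
    Σ N (λ t → sh X w t * sh t g n + v t * sh t g n)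
      ≡⟨ Σ-+ N (λ t → sh X w t * sh t g n) _ ⟩
    conv (sh X w) n + conv v n
      ≤⟨ +-mono-≤ (Σ-reindex X w (λ t → sh t g n) N) (dom N n) ⟩
    Σ N (λ t → w t * sh (X + t) g n) + f n
      ≡⟨ cong (_+ f n) (Σ-cong N (λ t _ → trans (cong (w t *_) (sym (sh-sh X t g n)))
                                                (sym (sh-* X (w t) (sh t g) n)))) ⟩
    Σ N (λ t → sh X (λ m → w t * sh t g m) n) + f n
      ≡⟨ cong (_+ f n) (Σ-sh N X (λ t m → w t * sh t g m) n) ⟩
    sh X (conv w) n + f n
      ≤⟨ +-monoˡ-≤ (f n) (shift-rel _≤_ ≤-refl X n (λ m e → ih (below e))) ⟩
    sh X (geom x f) n + f n
      ≡⟨ geom-unfold x f n ⟨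
    geom x f n ∎

-- Union bounds over large parts and over repeated parts.

seg-large : ∀ m k j f n →
  seg m (j + k) f n ≤ seg m k f n + Σ j (λ i → sh (suc (m + (i + k))) (seg m (j + k) f) n)
seg-large m k zero    f n = ≤-reflexive (sym (+-identityʳ _))
seg-large m k (suc j) f n = begin
  geom x h n                  ≡⟨ geom-unfold x h n ⟩
  S + h n                     ≤⟨ +-monoʳ-≤ S (seg-large m k j f n) ⟩
  S + (seg m k f n + Σ j (λ i → sh (suc (m + (i + k))) h n))
    ≤⟨ +-monoʳ-≤ S (+-monoʳ-≤ (seg m k f n) (Σ-mono j (λ i _ → sh-mono (suc (m + (i + k))) (geom-incl x h) n))) ⟩
  S + (seg m k f n + Σ j (λ i → sh (suc (m + (i + k))) (geom x h) n))
    ≡⟨ lem S (seg m k f n) _ ⟩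
  seg m k f n + Σ (suc j) (λ i → sh (suc (m + (i + k))) (geom x h) n) ∎
  where
  open ≤-Reasoning
  x = m + (j + k)
  h = seg m (j + k) f
  S = sh (suc x) (geom x h) n
  lem : ∀ a b c → a + (b + c) ≡ b + (c + a)
  lem = solve-∀

geom-of-Σ : ∀ x k (f : ℕ → ℕ → ℕ) n →
  geom x (λ n → Σ k (λ i → f i n)) n ≤ Σ k (λ i → geom x (f i) n)
geom-of-Σ x k f = geom-≥ x λ n → ≤-reflexive (begin
  sh (suc x) (λ n → Σ k (λ i → geom x (f i) n)) n + Σ k (λ i → f i n)
    ≡⟨ cong (_+ Σ k (λ i → f i n)) (Σ-sh k (suc x) (λ i → geom x (f i)) n) ⟨
  Σ k (λ i → sh (suc x) (geom x (f i)) n) + Σ k (λ i → f i n)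
    ≡⟨ Σ-+ k (λ i → sh (suc x) (geom x (f i)) n) _ ⟨
  Σ k (λ i → sh (suc x) (geom x (f i)) n + f i n)
    ≡⟨ Σ-cong k (λ i _ → sym (geom-unfold x (f i) n)) ⟩
  Σ k (λ i → geom x (f i) n) ∎)
  where open ≡-Reasoning

-- Pigeonhole: with `k` part sizes, all at most `m + k`, a total above `M k (m + k)` forces some
-- part to occur `M` times. In the induction, fewer than `M` copies of the largest part leave enough
-- for the other sizes.
seg-repeated : ∀ m k M n → M * (k * (m + k)) < n →
  seg m k δ n ≤ Σ k (λ i → sh (M * suc (m + i)) (seg m k δ) n)
seg-repeated m zero    M (suc n) p = z≤n
seg-repeated m (suc k) M n       p = begin
  geom x h n
    ≡⟨ geom-iterate x h M n ⟩
  Σ M (λ j → sh (j * X) h n) + sh (M * X) (geom x h) n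
    ≤⟨ +-monoˡ-≤ _ (Σ-mono M (λ j j<M → shift-rel _≤_ ≤-refl (j * X) n
         (λ m′ e → seg-repeated m k M m′ (room j m′ j<M e)))) ⟩
  Σ M (λ j → sh (j * X) H n) + sh (M * X) (geom x h) n
    ≤⟨ +-monoˡ-≤ _ (geom-Σ x H M n) ⟩
  geom x H n + sh (M * X) (geom x h) n
    ≤⟨ +-monoˡ-≤ _ (geom-of-Σ x k (λ i → sh (M * suc (m + i)) h) n) ⟩
  Σ k (λ i → geom x (sh (M * suc (m + i)) h) n) + sh (M * X) (geom x h) n
    ≡⟨ cong (_+ sh (M * X) (geom x h) n)
         (Σ-cong k (λ i _ → geom-sh x (M * suc (m + i)) h n)) ⟩
  Σ (suc k) (λ i → sh (M * suc (m + i)) (geom x h) n) ∎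
  where
  open ≤-Reasoning
  x = m + k
  X = suc x
  h = seg m k δ
  H = λ n → Σ k (λ i → sh (M * suc (m + i)) h n)
  lem : ∀ m k → (1 + k) * (m + (1 + k)) ≡ k * (m + k) + (1 + (m + k)) + k
  lem = solve-∀
  room : ∀ j m′ → j < M → m′ + j * X ≡ n → M * (k * (m + k)) < m′
  room j m′ j<M refl = +-cancelʳ-< (M * X) _ _ (begin-strict
    M * (k * (m + k)) + M * X       ≡⟨ *-distribˡ-+ M _ X ⟨
    M * (k * (m + k) + X)           ≤⟨ *-monoʳ-≤ M (≤-trans (m≤m+n _ k) (≤-reflexive (sym (lem m k)))) ⟩
    M * (suc k * (m + suc k))       <⟨ p ⟩
    m′ + j * X                      ≤⟨ +-monoʳ-≤ m′ (*-monoˡ-≤ X (<⇒≤ j<M)) ⟩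
    m′ + M * X                      ∎)

-- The sum counts objects with fewer than `M` copies of a part `x`. Removing the `j` copies gives a
-- term at most `P / (M c)` at index `n - j x`, and `P` does not decrease when they are put back.
sum-of-shifts : ∀ x M c B {f P} → (∀ m → B < m → M * c * f m ≤ P m) → (∀ n → sh x P n ≤ P n) →
  ∀ n → B + M * x < n → c * Σ M (λ j → sh (j * x) f n) ≤ P n
sum-of-shifts x M c B {f} {P} bound step n p = Σ-average M c _ λ j j<M → begin
  M * c * sh (j * x) f n             ≡⟨ sh-* (j * x) (M * c) f n ⟨
  sh (j * x) (λ m → M * c * f m) n   ≤⟨ shift-rel _≤_ ≤-refl (j * x) n (λ m e → bound m (room j m j<M e)) ⟩
  sh (j * x) P n                     ≤⟨ sh-multiple x step j n ⟩
  P n                                ∎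
  where
  open ≤-Reasoning
  room : ∀ j m → j < M → m + j * x ≡ n → B < m
  room j m j<M refl = +-cancelʳ-< (M * x) _ _ (<-≤-trans p (+-monoʳ-≤ m (*-monoˡ-≤ x (<⇒≤ j<M))))

double-cancel : ∀ K {g P} → 2 * K * g ≤ P + P → K * g ≤ P
double-cancel K {g} {P} le = *-cancelˡ-≤ 2 (≤-trans (≤-reflexive (sym (*-assoc 2 K g)))
  (≤-trans le (≤-reflexive (cong (P +_) (sym (+-identityʳ P))))))

-- Few partitions avoid s + 1.

module _ (s K : ℕ) where

  private
    ab = suc s * suc (suc s)

  -- A part above sizeBound, or multBound copies of a part, can be rewritten by
  -- parts s + 1 and s + 2 in at least 2 K, respectively 2 K sizeBound, ways.
  sizeBound : ℕ
  sizeBound = 2 * K * ab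

  multBound : ℕ
  multBound = sizeBound * (2 * K) * ab

  -- The pigeonhole bound of `seg-repeated` for `multBound` copies and at most `sizeBound` part
  -- sizes starting at s + 3.
  noTwoBound : ℕ
  noTwoBound = multBound * (sizeBound * (suc (suc s) + sizeBound))

  private
    -- Partitions with all parts at most `m + k` repeat some part `multBound` times; the others
    -- contain a larger part. Either portion of total `t` is rewritten in `reps s t` ways, so each
    -- class contributes at most `P / (2 K)`.
    few-without-two-split : ∀ j k n → noTwoBound < n → k ≤ sizeBound →
      (∀ i → i < j → sizeBound ≤ suc (suc (suc s) + (i + k))) →
      let g = seg (suc (suc s)) (j + k) δ in K * g n ≤ geom s (geom (suc s) g) n
    few-without-two-split j k n big k≤C large = double-cancel K (begin
      2 * K * g n                     ≤⟨ *-monoʳ-≤ (2 * K) (seg-large m k j δ n) ⟩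
      2 * K * (seg m k δ n + Z)       ≡⟨ *-distribˡ-+ (2 * K) (seg m k δ n) Z ⟩
      2 * K * seg m k δ n + 2 * K * Z ≤⟨ +-mono-≤ smallParts largeParts ⟩
      P n + P n                       ∎)
      where
      open ≤-Reasoning
      m = suc (suc s)
      g = seg m (j + k) δ
      P = geom s (geom (suc s) g)
      Z = Σ j (λ i → sh (suc (m + (i + k))) g n)
      dom : Dominates P (reps s) g
      dom = geom-dominates s (geom-dominates (suc s) (δ-dominated g))
      single : ∀ t → reps s t * sh t g n ≤ P n
      single t = ≤-trans (m≤n+m _ _) (dom (suc t) n)

      smallParts : 2 * K * seg m k δ n ≤ P n
      smallParts = ≤-trans
        (*-monoʳ-≤ (2 * K) (seg-repeated m k multBound n
          (≤-<-trans (*-monoʳ-≤ multBound (*-mono-≤ k≤C (+-monoʳ-≤ m k≤C))) big)))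
        (Σ-average k (2 * K) _ λ i _ → begin
          k * (2 * K) * sh (multBound * suc (m + i)) (seg m k δ) n
            ≤⟨ *-mono-≤ (*-monoˡ-≤ (2 * K) k≤C) (sh-mono (multBound * suc (m + i)) (seg-incl m j k δ) n) ⟩
          sizeBound * (2 * K) * sh (multBound * suc (m + i)) g n
            ≤⟨ *-monoˡ-≤ (sh (multBound * suc (m + i)) g n)
                  (reps-≥ s (sizeBound * (2 * K)) (multBound * suc (m + i)) (m≤m*n multBound (suc (m + i)))) ⟩
          reps s (multBound * suc (m + i)) * sh (multBound * suc (m + i)) g n
            ≤⟨ single (multBound * suc (m + i)) ⟩
          P n ∎)

      lem : ∀ i k m → 1 + (m + (i + k)) ≡ i + (1 + (m + k))
      lem = solve-∀
      -- Distinct large parts are distinct terms of a single product of series, so their sum is at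
      -- most `P n` however many there are. This keeps the bound free of `j`.
      largeParts : 2 * K * Z ≤ P n
      largeParts = begin
        2 * K * Z
          ≡⟨ Σ-* j (2 * K) _ ⟨
        Σ j (λ i → 2 * K * sh (suc (m + (i + k))) g n)
          ≤⟨ Σ-mono j (λ i i<j → *-monoˡ-≤ (sh (suc (m + (i + k))) g n)
               (reps-≥ s (2 * K) (suc (m + (i + k))) (large i i<j))) ⟩
        Σ j (λ i → reps s (suc (m + (i + k))) * sh (suc (m + (i + k))) g n)
          ≡⟨ Σ-cong j (λ i _ → cong (λ t → reps s t * sh t g n) (lem i k m)) ⟩
        Σ j (λ i → reps s (i + suc (m + k)) * sh (i + suc (m + k)) g n)
          ≤⟨ m≤n+m _ (Σ (suc (m + k)) (λ t → reps s t * sh t g n)) ⟩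
        Σ (suc (m + k)) (λ t → reps s t * sh t g n)
          + Σ j (λ i → reps s (i + suc (m + k)) * sh (i + suc (m + k)) g n)
          ≡⟨ Σ-split (suc (m + k)) j (λ t → reps s t * sh t g n) ⟨
        Σ (j + suc (m + k)) (λ t → reps s t * sh t g n)
          ≤⟨ dom (j + suc (m + k)) n ⟩
        P n ∎

  -- At most `sizeBound` part sizes are treated as small. The bound on `n` does not involve `k`,
  -- which is the source of uniformity in L.
  few-without-two : ∀ k n → noTwoBound < n →
    let g = seg (suc (suc s)) k δ in K * g n ≤ geom s (geom (suc s) g) n
  few-without-two k n big with k ≤? sizeBound
  ... | yes k≤C = few-without-two-split 0 k n big k≤C (λ i ())
  ... | no  k≰C = subst (λ k → let g = seg (suc (suc s)) k δ in K * g n ≤ geom s (geom (suc s) g) n)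
    (m∸n+n≡m (<⇒≤ (≰⇒> k≰C)))
    (few-without-two-split (k ∸ sizeBound) sizeBound n big ≤-refl λ i _ →
      ≤-trans (m≤n+m sizeBound i) (m≤n+m _ (suc (suc (suc s)))))

geom-iterate-≥ : ∀ x f M n → sh (suc M * suc x) (geom x f) n + f n ≤ geom x f n
geom-iterate-≥ x f M n = begin
  sh (suc M * suc x) (geom x f) n + f n
    ≤⟨ +-monoʳ-≤ _ (Σ-term (suc M) (λ k → sh (k * suc x) f n) 0 z<s) ⟩
  sh (suc M * suc x) (geom x f) n + Σ (suc M) (λ k → sh (k * suc x) f n)
    ≡⟨ +-comm (sh (suc M * suc x) (geom x f) n) _ ⟩
  Σ (suc M) (λ k → sh (k * suc x) f n) + sh (suc M * suc x) (geom x f) n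
    ≡⟨ geom-iterate x f (suc M) n ⟨
  geom x f n ∎
  where open ≤-Reasoning

-- Given `E a` copies of `b`, one may turn `i a` of them into `i b` copies of `a` for each `i < E`.
-- The results differ in the number of parts `a`.
exchange : ∀ s g E n → let e = geom (suc s) g in
  E * sh (E * suc s * suc (suc s)) e n ≤ geom s e n
exchange s g zero    n = z≤n
exchange s g (suc E) n = begin
  suc E * sh (suc E * a * b) e n
    ≡⟨⟩
  sh (suc E * a * b) e n + E * sh (suc E * a * b) e n
    ≡⟨ cong (λ z → sh (suc E * a * b) e n + E * sh z e n) (lem E a b) ⟩
  sh (suc E * a * b) e n + E * sh (b * a + E * a * b) e n
    ≤⟨ +-monoˡ-≤ _ (sh-multiple b (geom-step a g) (suc E * a) n) ⟩
  e n + E * sh (b * a + E * a * b) e n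
    ≡⟨ cong (λ z → e n + E * z) (sh-sh (b * a) (E * a * b) e n) ⟨
  e n + E * sh (b * a) (sh (E * a * b) e) n
    ≡⟨ cong (e n +_) (sh-* (b * a) E (sh (E * a * b) e) n) ⟨
  e n + sh (b * a) (λ n → E * sh (E * a * b) e n) n
    ≤⟨ +-monoʳ-≤ (e n) (sh-mono (b * a) (exchange s g E) n) ⟩
  e n + sh (b * a) (geom s e) n
    ≡⟨ +-comm (e n) _ ⟩
  sh (b * a) (geom s e) n + e n
    ≤⟨ geom-iterate-≥ s e a n ⟩
  geom s e n ∎
  where
  open ≤-Reasoning
  a = suc s
  b = suc a
  e = geom a g
  lem : ∀ E a b → (1 + E) * a * b ≡ b * a + E * a * b
  lem = solve-∀

module _ (s K : ℕ) where

  private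
    M = 2 * K * suc s

  noOneBound : ℕ
  noOneBound = noTwoBound s (M * (2 * K)) + M * suc (suc s)

  -- Split by the number of parts s + 2. Fewer than `M` copies reduce to `few-without-two` with the
  -- extra factor `M`; since `M` is `2 K` groups of s + 1 copies, at least `M` copies allow `2 K`
  -- exchanges.
  few-without-one : ∀ k n → noOneBound < n →
    let e = geom (suc s) (seg (suc (suc s)) k δ) in K * e n ≤ geom s e n
  few-without-one k n big = double-cancel K (begin
    2 * K * e n                 ≡⟨ cong (2 * K *_) (geom-iterate (suc s) g M n) ⟩
    2 * K * (S + T)             ≡⟨ *-distribˡ-+ (2 * K) S T ⟩
    2 * K * S + 2 * K * T
      ≤⟨ +-mono-≤ (sum-of-shifts (suc (suc s)) M (2 * K) (noTwoBound s (M * (2 * K)))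
                     (few-without-two s (M * (2 * K)) k)
                     (geom-step-preserved s (suc (suc s)) (geom-step (suc s) g)) n big)
                  (exchange s g (2 * K) n) ⟩
    geom s e n + geom s e n     ∎)
    where
    open ≤-Reasoning
    g = seg (suc (suc s)) k δ
    e = geom (suc s) g
    S = Σ M (λ j → sh (j * suc (suc s)) g n)
    T = sh (M * suc (suc s)) e n

-- Slow growth and the inequality between the two series.

module _ (s d c : ℕ) where

  slowBound : ℕ
  slowBound = noOneBound s (d * c) + d * suc s

  -- The increase from p(n - d(s + 1)) to p(n) counts partitions with fewer than `d` parts s + 1, at
  -- most p(n)/c of them by `few-without-one`.
  slow-growth : ∀ L n → 2 ≤ L → slowBound < n →
    c * seg s L δ n ≤ seg s L δ n + c * sh (d * suc s) (seg s L δ) n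
  slow-growth L n 2≤L big with m≤n⇒∃[o]m+o≡n 2≤L
  ... | k , refl = begin
    c * p n                 ≡⟨ cong (c *_) (p≡ n) ⟩
    c * q n                 ≡⟨ cong (c *_) (geom-iterate s e d n) ⟩
    c * (S + sh D q n)      ≡⟨ *-distribˡ-+ c S _ ⟩
    c * S + c * sh D q n
      ≤⟨ +-monoˡ-≤ _ (sum-of-shifts (suc s) d c (noOneBound s (d * c)) (few-without-one s (d * c) k)
           (geom-step s e) n big) ⟩
    q n + c * sh D q n      ≡⟨ cong₂ _+_ (p≡ n) (cong (c *_) (sh-cong D p≡ n)) ⟨
    p n + c * sh D p n      ∎
    where
    open ≤-Reasoning
    p = seg s (2 + k) δ
    e = geom (suc s) (seg (suc (suc s)) k δ)
    q = geom s e
    D = d * suc s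
    S = Σ d (λ j → sh (j * suc s) e n)
    p≡ : ∀ n → p n ≡ q n
    p≡ n = trans (seg-front s (suc k) δ n) (geom-cong s (seg-front (suc s) k δ) n)

-- The choice d = 3(s + 1) makes the distance d(s + 1) exceed all head shifts by a full gap; c = 3s
-- + 3 is one more than the number of positive head terms.
threshold : ℕ → ℕ
threshold s = slowBound s (3 * suc s) (3 * suc s)

series-inequality : ∀ s′ L′ n → let s = suc s′ in s ≤ L′ → threshold s < n →
  geom L′ (seg s (suc L′) δ) n < sh s (geom s′ (seg s (suc L′) δ)) n
series-inequality s′ L′ n s≤L′ big = begin-strict
  geom L′ p n
    -- Terms beyond index `n` vanish; taking `suc n` terms after the head gives both tails the same
    -- length.
    ≡⟨ geom-Σ-full L′ p (suc n + N) n (m≤m+n (suc n) N) ⟩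
  Σ (suc n + N) (λ k → sh (k * L) p n)
    ≡⟨ Σ-split N (suc n) (λ k → sh (k * L) p n) ⟩
  Σ N (λ k → sh (k * L) p n) + Σ (suc n) (λ i → sh ((i + N) * L) p n)
    ≤⟨ +-mono-≤ (Σ-≤const N (λ k _ → sh-multiple L (seg-gap s L δ (s≤s s≤L′) L (s≤s s≤L′)) k n))
                (Σ-mono (suc n) λ i _ → seg-anti s L δ (s≤s s≤L′) (s + (i + suc N) * s) ((i + N) * L) (tail i) n) ⟩
  N * p n + tailSum
    <⟨ +-monoˡ-< tailSum head ⟩
  suc N * sh D p n + tailSum
    ≤⟨ +-monoˡ-≤ tailSum (Σ-≥const (suc N) λ k k≤N → seg-anti s L δ (s≤s s≤L′) (s + k * s) D (early k k≤N) n) ⟩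
  Σ (suc N) (λ k → sh (s + k * s) p n) + tailSum
    ≡⟨ Σ-split (suc N) (suc n) (λ k → sh (s + k * s) p n) ⟨
  Σ (suc n + suc N) (λ k → sh (s + k * s) p n)
    ≡⟨ Σ-cong (suc n + suc N) (λ k _ → sym (sh-sh s (k * s) p n)) ⟩
  Σ (suc n + suc N) (λ k → sh s (sh (k * s) p) n)
    ≡⟨ Σ-sh (suc n + suc N) s (λ k → sh (k * s) p) n ⟩
  sh s (λ m → Σ (suc n + suc N) (λ k → sh (k * s) p m)) n
    ≤⟨ sh-mono s (geom-Σ s′ p (suc n + suc N)) n ⟩
  sh s (geom s′ p) n ∎
  where
  open ≤-Reasoning
  s = suc s′
  L = suc L′
  p = seg s L δ
  -- Since `L ≥ s + 1`, the shifts j L and (j + 2) s differ by at least j - 2s, which reaches the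
  -- gap s + 1 exactly from j = 3s + 1 on.
  N = 1 + 3 * s
  D = 3 * suc s * suc s
  tailSum = Σ (suc n) (λ i → sh (s + (i + suc N) * s) p n)

  tail : ∀ i → s + (i + suc N) * s + suc s ≤ (i + N) * L
  tail i = begin
    s + (i + suc N) * s + suc s        ≤⟨ m≤m+n _ i ⟩
    s + (i + suc N) * s + suc s + i    ≡⟨ lem i s ⟩
    (i + N) * suc s                    ≤⟨ *-monoʳ-≤ (i + N) (s≤s s≤L′) ⟩
    (i + N) * L                        ∎
    where
    lem : ∀ i s → s + (i + (2 + 3 * s)) * s + (1 + s) + i ≡ (i + (1 + 3 * s)) * (1 + s)
    lem = solve-∀

  early : ∀ k → k < suc N → s + k * s + suc s ≤ D
  early k k≤N = begin
    s + k * s + suc s                    ≤⟨ +-monoˡ-≤ (suc s) (+-monoʳ-≤ s (*-monoˡ-≤ s (s≤s⁻¹ k≤N))) ⟩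
    s + N * s + suc s                    ≤⟨ m≤m+n _ (2 + 3 * s) ⟩
    s + N * s + suc s + (2 + 3 * s)      ≡⟨ lem s ⟩
    D                                    ∎
    where
    lem : ∀ s → s + (1 + 3 * s) * s + (1 + s) + (2 + 3 * s) ≡ 3 * (1 + s) * (1 + s)
    lem = solve-∀

  growth : suc N * p n ≤ suc (suc N) * sh D p n
  growth = +-cancelˡ-≤ (p n) _ _ (subst (λ c → c * p n ≤ p n + c * sh D p n) (lem s)
    (slow-growth s (3 * suc s) (3 * suc s) L n (s≤s (≤-trans (s≤s z≤n) s≤L′)) big))
    where
    lem : ∀ s → 3 * (1 + s) ≡ 2 + (1 + 3 * s)
    lem = solve-∀

  -- The identity (N + 1)² = N(N + 2) + 1 leaves one spare `p n`, which is positive; hence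
  -- strictness.
  head : N * p n < suc N * sh D p n
  head = *-cancelˡ-< (suc (suc N)) _ _ (begin-strict
    suc (suc N) * (N * p n)              <⟨ m<m+n _ (seg-pos s L (s≤s s≤L′) n s<n) ⟩
    suc (suc N) * (N * p n) + p n        ≡⟨ lem N (p n) ⟩
    suc N * (suc N * p n)                ≤⟨ *-monoʳ-≤ (suc N) growth ⟩
    suc N * (suc (suc N) * sh D p n)     ≡⟨ lem′ N (sh D p n) ⟩
    suc (suc N) * (suc N * sh D p n)     ∎)
    where
    lem : ∀ j p → (2 + j) * (j * p) + p ≡ (1 + j) * ((1 + j) * p)
    lem = solve-∀
    lem′ : ∀ j y → (1 + j) * ((2 + j) * y) ≡ (2 + j) * ((1 + j) * y)
    lem′ = solve-∀
    s<n : s < n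
    s<n = begin-strict
      s                                  <⟨ n<1+n s ⟩
      suc s                              ≤⟨ m≤n*m (suc s) (3 * suc s) ⟩
      3 * suc s * suc s                  ≤⟨ m≤n+m _ (noOneBound s (3 * suc s * (3 * suc s))) ⟩
      threshold s                        <⟨ big ⟩
      n                                  ∎

-- Explicit lists of partitions.

unique-⊆-length : ∀ {A : Set} {xs ys : List A} → Unique xs → (∀ {x} → x ∈ xs → x ∈ ys) → length xs ≤ length ys
unique-⊆-length {xs = []} [] sub = z≤n
unique-⊆-length {xs = x ∷ xs} (x∉ ∷ u) sub with ∈-∃++ (sub (here refl))
... | ys , zs , refl = begin
  suc (length xs)             ≤⟨ s≤s (unique-⊆-length u rest) ⟩
  suc (length (ys ++ zs))     ≡⟨ cong suc (length-++ ys) ⟩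
  suc (length ys + length zs) ≡⟨ +-suc (length ys) (length zs) ⟨
  length ys + suc (length zs) ≡⟨ length-++ ys ⟨
  length (ys ++ x ∷ zs)       ∎
  where
  open ≤-Reasoning
  rest : ∀ {y} → y ∈ xs → y ∈ ys ++ zs
  rest y∈xs with ∈-++⁻ ys (sub (there y∈xs))
  ... | inj₁ y∈ys          = ∈-++⁺ˡ y∈ys
  ... | inj₂ (here refl)   = contradiction refl (All.lookup x∉ y∈xs)
  ... | inj₂ (there y∈zs)  = ∈-++⁺ʳ ys y∈zs

Family : Set
Family = ℕ → List (List ℕ)

-- Lists of F with any number of parts x + 1 put in front.
prepend : ℕ → Family → Family
prepend x = Recursion.solution (λ ls ms → map (suc x ∷_) ls ++ ms) [] x

prepend-unfold : ∀ x F n →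
  prepend x F n ≡ map (suc x ∷_) (shift [] (suc x) (prepend x F) n) ++ F n
prepend-unfold x F = Recursion.unfold (λ ls ms → map (suc x ∷_) ls ++ ms) [] x F

shift-length : ∀ x (F : Family) n → length (shift [] x F n) ≡ sh x (length ∘ F) n
shift-length x F n = shift-rel (λ l k → length l ≡ k) refl x n (λ _ _ → refl)

-- Taking lengths turns the recursion on lists into that of `geom`, whose solution is unique.
prepend-length : ∀ x F n → length (prepend x F n) ≡ geom x (length ∘ F) n
prepend-length x F = geom-unique x λ n → begin
  length (prepend x F n)
    ≡⟨ cong length (prepend-unfold x F n) ⟩
  length (map (suc x ∷_) (shift [] (suc x) (prepend x F) n) ++ F n)
    ≡⟨ length-++ (map (suc x ∷_) (shift [] (suc x) (prepend x F) n)) ⟩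
  length (map (suc x ∷_) (shift [] (suc x) (prepend x F) n)) + length (F n)
    ≡⟨ cong (_+ length (F n)) (trans (length-map (suc x ∷_) (shift [] (suc x) (prepend x F) n))
         (shift-length (suc x) (prepend x F) n)) ⟩
  sh (suc x) (length ∘ prepend x F) n + length (F n) ∎
  where open ≡-Reasoning

prepend-skip : ∀ x F n {π} → π ∈ F n → π ∈ prepend x F n
prepend-skip x F n h = subst (_ ∈_) (sym (prepend-unfold x F n)) (∈-++⁺ʳ _ h)

prepend-take : ∀ x F n {π} → π ∈ prepend x F n → suc x ∷ π ∈ prepend x F (suc x + n)
prepend-take x F n h = subst (_ ∈_) (sym (prepend-unfold x F (suc x + n)))
  (∈-++⁺ˡ (∈-map⁺ (suc x ∷_) (subst (_ ∈_) (sym (shift-at [] (suc x) (prepend x F) n)) h)))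

prepend-All : ∀ {P : ℕ → List ℕ → Set} x {F} → (∀ n → All (P n) (F n)) →
  (∀ n {π} → P n π → P (n + suc x) (suc x ∷ π)) → ∀ n → All (P n) (prepend x F n)
prepend-All {P} x {F} base step = <-rec _ λ n ih → subst (All (P n)) (sym (prepend-unfold x F n))
  (All.++⁺ (All.map⁺ (shift-rel (λ l _ → All (P n ∘ (suc x ∷_)) l) {d′ = tt} [] (suc x) {g = λ _ → tt} n
    λ m e → All.map (λ p → subst (λ k → P k _) e (step m p)) (ih (below e)))) (base n))

-- The last entry is ignored because in ending m 0 below it exceeds m + 0.
top : List ℕ → ℕ
top []          = 0
top (x ∷ [])    = 0
top (x ∷ y ∷ π) = x

-- A new list is x + 1 in front of a nonempty list, so its `top` is x + 1, whereas lists of `F` have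
-- `top` at most `x`; the two halves are disjoint.
prepend-Unique : ∀ x {F} → (∀ n → Unique (F n)) → (∀ n → All NonEmpty (F n)) →
  (∀ n → All (λ π → top π ≤ x) (F n)) → ∀ n → Unique (prepend x F n)
prepend-Unique x {F} uniq nonEmpty small = <-rec _ λ n ih → subst Unique (sym (prepend-unfold x F n))
  (Unique.++⁺
    (Unique.map⁺ ∷-injectiveʳ (shift-rel (λ l _ → Unique l) {d′ = tt} [] (suc x) {g = λ _ → tt} n
      λ m e → ih (below e)))
    (uniq n)
    λ { (π∈map , π∈F) → disjoint n (∈-map⁻ (suc x ∷_) π∈map) (All.lookup (small n) π∈F) })
  where
  members : ∀ n → All NonEmpty (shift [] (suc x) (prepend x F) n)
  members n = shift-rel (λ l _ → All NonEmpty l) {d′ = tt} [] (suc x) {g = λ _ → tt} n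
    λ m _ → prepend-All {λ _ → NonEmpty} x nonEmpty (λ _ _ → tt) m
  disjoint : ∀ n {π} → ∃[ ρ ] (ρ ∈ shift [] (suc x) (prepend x F) n × π ≡ suc x ∷ ρ) → top π ≤ x → ⊥
  disjoint n (ρ , ρ∈ , refl) with ρ | All.lookup (members n) ρ∈
  ... | _ ∷ _ | _ = 1+n≰n

-- The partitions with smallest part m + 1 and all other parts at most m + k.
ending : ℕ → ℕ → Family
ending m zero    = shift [] (suc m) λ { zero → (suc m ∷ []) ∷ [] ; (suc _) → [] }
ending m (suc k) = prepend (m + k) (ending m k)

ending-length : ∀ m k n → length (ending m k n) ≡ sh (suc m) (seg m k δ) n
ending-length m k n = trans (go k n) (seg-sh m k (suc m) δ n)
  where
  go : ∀ k n → length (ending m k n) ≡ seg m k (sh (suc m) δ) n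
  go zero    n = shift-rel (λ l j → length l ≡ j) refl (suc m) n λ { zero _ → refl ; (suc _) _ → refl }
  go (suc k) n = trans (prepend-length (m + k) (ending m k) n) (geom-cong (m + k) (go k) n)

ending-singleton : ∀ m k → suc m ∷ [] ∈ ending m k (suc m)
ending-singleton m zero    = subst (λ n → suc m ∷ [] ∈ ending m zero n) (+-identityʳ (suc m))
  (subst (λ l → suc m ∷ [] ∈ l) (sym (shift-at [] (suc m) _ 0)) (here refl))
ending-singleton m (suc k) = prepend-skip (m + k) (ending m k) (suc m) (ending-singleton m k)

smallest≤largest : ∀ x π → Linked _≥_ (x ∷ π) → smallest (x ∷ π) ≤ x
smallest≤largest x []      _       = ≤-refl
smallest≤largest x (y ∷ π) (r ∷ l) = ≤-trans (smallest≤largest y π l) r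

ending-complete : ∀ m k x π → Linked _≥_ (x ∷ π) → smallest (x ∷ π) ≡ suc m → x ≤ m + k →
  x ∷ π ∈ ending m k (sum (x ∷ π))
ending-complete m zero    x π l e x≤ = contradiction
  (≤-trans (≤-reflexive (sym e)) (≤-trans (smallest≤largest x π l)
    (≤-trans x≤ (≤-reflexive (+-identityʳ m))))) 1+n≰n
-- The inner recursion on the list keeps `k` fixed, as the part m + k + 1 may repeat; `k` drops once
-- the head is smaller.
ending-complete m (suc k) = go
  where
  go : ∀ x π → Linked _≥_ (x ∷ π) → smallest (x ∷ π) ≡ suc m → x ≤ m + suc k →
    x ∷ π ∈ ending m (suc k) (sum (x ∷ π))
  go x [] l refl x≤ = subst (λ n → x ∷ [] ∈ ending m (suc k) n) (sym (+-identityʳ (suc m)))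
    (ending-singleton m (suc k))
  go x (y ∷ π) (r ∷ l) e x≤ with x ≟ suc (m + k)
  ... | yes refl = prepend-take (m + k) (ending m k) (sum (y ∷ π)) (go y π l e (≤-trans r x≤))
  ... | no  x≢   = prepend-skip (m + k) (ending m k) (sum (x ∷ y ∷ π))
    (ending-complete m k x (y ∷ π) (r ∷ l) e (s≤s⁻¹ (≤∧≢⇒< (≤-trans x≤ (≤-reflexive (+-suc m k))) x≢)))

IsEnding : ℕ → ℕ → ℕ → List ℕ → Set
IsEnding m k n π = IsPartition n π × NonEmpty π × smallest π ≡ suc m × top π ≤ m + k

ending-sound : ∀ m k n → All (IsEnding m k n) (ending m k n)
ending-sound m zero    n = shift-rel (λ l _ → All (IsEnding m 0 n) l) {d′ = tt} [] (suc m) {g = λ _ → tt} n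
  λ { zero e → (([-] , (z<s ∷ []) , trans (+-identityʳ (suc m)) e) , tt , refl , z≤n) ∷ []
    ; (suc _) _ → [] }
ending-sound m (suc k) = prepend-All {IsEnding m (suc k)} (m + k)
  (λ n → All.map (λ { (p , q , r , t) → p , q , r , ≤-trans t (+-monoʳ-≤ m (n≤1+n k)) }) (ending-sound m k n))
  cons
  where
  cons : ∀ n {π} → IsEnding m (suc k) n π → IsEnding m (suc k) (n + suc (m + k)) (suc (m + k) ∷ π)
  cons n {x ∷ π} ((l , pos , eq) , _ , r , t) =
    (bound π r t ∷ l , z<s ∷ pos , trans (cong (suc (m + k) +_) eq) (+-comm (suc (m + k)) n)) , tt , r ,
    ≤-reflexive (sym (+-suc m k))
    where
    bound : ∀ π → smallest (x ∷ π) ≡ suc m → top (x ∷ π) ≤ m + suc k → x ≤ suc (m + k)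
    bound []      r t = ≤-trans (≤-reflexive r) (s≤s (m≤m+n m k))
    bound (_ ∷ _) r t = ≤-trans t (≤-reflexive (+-suc m k))

ending-unique : ∀ m k n → Unique (ending m k n)
ending-unique m zero    n = shift-rel (λ l _ → Unique l) {d′ = tt} [] (suc m) {g = λ _ → tt} n
  λ { zero _ → [] ∷ [] ; (suc _) _ → [] }
ending-unique m (suc k) = prepend-Unique (m + k) (ending-unique m k)
  (λ n → All.map (λ h → proj₁ (proj₂ h)) (ending-sound m k n))
  (λ n → All.map (λ h → proj₂ (proj₂ (proj₂ h))) (ending-sound m k n))

IsEnding⇒PosPart : ∀ s L n {π} → IsEnding s (suc L) n π → PosPart L (suc s) n π
IsEnding⇒PosPart s L n {x ∷ π} (p , q , r , t) = p , q , r , m≤n+o⇒m∸n≤o x (smallest (x ∷ π)) (bound π r t)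
  where
  bound : ∀ π → smallest (x ∷ π) ≡ suc s → top (x ∷ π) ≤ s + suc L → x ≤ smallest (x ∷ π) + L
  bound []      r t = m≤m+n _ L
  bound (_ ∷ _) r t = ≤-trans t (≤-reflexive (trans (+-suc s L) (cong (_+ L) (sym r))))

-- Negative partitions, grouped by smallest part.

endings : ℕ → ℕ → ℕ → Family
endings s k zero    n = []
endings s k (suc r) n = endings s k r n ++ ending (s + r) k n

endings-∈ : ∀ s k r i n {π} → i < r → π ∈ ending (s + i) k n → π ∈ endings s k r n
endings-∈ s k (suc r) i n i<r h with m≤n⇒m<n∨m≡n (s≤s⁻¹ i<r)
... | inj₁ p    = ∈-++⁺ˡ (endings-∈ s k r i n p h)
... | inj₂ refl = ∈-++⁺ʳ (endings s k r n) h

smallest≤sum : ∀ π → smallest π ≤ sum π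
smallest≤sum []          = z≤n
smallest≤sum (x ∷ [])    = m≤m+n x 0
smallest≤sum (x ∷ y ∷ π) = ≤-trans (smallest≤sum (y ∷ π)) (m≤n+m _ x)

NegPart⇒∈endings : ∀ L s n {π} → NegPart L s n π → π ∈ endings s (suc L) n n
NegPart⇒∈endings L s n {x ∷ π} ((l , pos , refl) , _ , s<m , d) with m≤n⇒∃[o]m+o≡n s<m
-- The smallest part is s + i + 1, and it is at most the sum `n`, so `n` groups suffice.
... | i , eq = endings-∈ s (suc L) n i n
  (≤-trans (≤-trans (s≤s (m≤n+m i s)) (≤-reflexive eq)) (smallest≤sum (x ∷ π)))
  (ending-complete (s + i) (suc L) x π l (sym eq) (begin
    x                          ≤⟨ ≤-trans (m≤n+m∸n x (smallest (x ∷ π))) (+-monoʳ-≤ (smallest (x ∷ π)) d) ⟩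
    smallest (x ∷ π) + L       ≡⟨ cong (_+ L) eq ⟨
    suc (s + i + L)            ≡⟨ +-suc (s + i) L ⟨
    s + i + suc L              ∎))
  where open ≤-Reasoning

-- Partitions into parts from m + 1, …, m + 1 + L are split by whether m + 1
-- occurs, and by whether m + 1 + L occurs; the equality telescopes over m.
endings-telescope : ∀ s L r n → length (endings s (suc L) r n) + seg (s + r) L δ n ≡
  sh L (λ n → length (endings s (suc L) r n)) n + seg s L δ n
endings-telescope s L zero    n = trans (cong (λ m → seg m L δ n) (+-identityʳ s))
  (cong (_+ seg s L δ n) (sym (sh-0 L n)))
endings-telescope s L (suc r) n = begin
  length (endings s (suc L) r n ++ ending m (suc L) n) + seg (s + suc r) L δ n
    ≡⟨ cong₂ _+_ (len n) (cong (λ m → seg m L δ n) (+-suc s r)) ⟩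
  S n + T n + seg (suc m) L δ n
    ≡⟨ +-assoc (S n) _ _ ⟩
  S n + (T n + seg (suc m) L δ n)
    ≡⟨ cong (S n +_) exchange-ends ⟩
  S n + (sh L T n + seg m L δ n)
    ≡⟨ lem (S n) (sh L T n) (seg m L δ n) ⟩
  sh L T n + (S n + seg m L δ n)
    ≡⟨ cong (sh L T n +_) (endings-telescope s L r n) ⟩
  sh L T n + (sh L S n + seg s L δ n)
    ≡⟨ lem′ (sh L T n) (sh L S n) (seg s L δ n) ⟩
  sh L S n + sh L T n + seg s L δ n
    ≡⟨ cong (_+ seg s L δ n) (sh-+ L S T n) ⟨
  sh L (λ n → S n + T n) n + seg s L δ n
    ≡⟨ cong (_+ seg s L δ n) (sh-cong L len n) ⟨
  sh L (λ n → length (endings s (suc L) (suc r) n)) n + seg s L δ n ∎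
  where
  open ≡-Reasoning
  m = s + r
  f = seg m (suc L) δ
  S = λ n → length (endings s (suc L) r n)
  T = sh (suc m) f
  len : ∀ n → length (endings s (suc L) r n ++ ending m (suc L) n) ≡ S n + T n
  len n = trans (length-++ (endings s (suc L) r n)) (cong (S n +_) (ending-length m (suc L) n))
  lem : ∀ a b c → a + (b + c) ≡ b + (a + c)
  lem = solve-∀
  lem′ : ∀ a b c → a + (b + c) ≡ b + a + c
  lem′ = solve-∀
  exchange-ends : T n + seg (suc m) L δ n ≡ sh L T n + seg m L δ n
  exchange-ends = begin
    T n + seg (suc m) L δ n
      ≡⟨ cong (_+ seg (suc m) L δ n) (sh-cong (suc m) (seg-front m L δ) n) ⟩
    sh (suc m) (geom m (seg (suc m) L δ)) n + seg (suc m) L δ n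
      ≡⟨ geom-unfold m (seg (suc m) L δ) n ⟨
    geom m (seg (suc m) L δ) n
      ≡⟨ seg-front m L δ n ⟨
    f n
      ≡⟨ geom-unfold (m + L) (seg m L δ) n ⟩
    sh (suc (m + L)) f n + seg m L δ n
      ≡⟨ cong (λ k → sh k f n + seg m L δ n) (+-comm (suc m) L) ⟩
    sh (L + suc m) f n + seg m L δ n
      ≡⟨ cong (_+ seg m L δ n) (sh-sh L (suc m) f n) ⟨
    sh L T n + seg m L δ n ∎

-- Dropping the series at `s + r` from the telescoped identity leaves a subsolution of the recursion
-- of `geom L`.
endings-length : ∀ s L r n → length (endings s (suc (suc L)) r n) ≤ geom L (seg s (suc L) δ) n
endings-length s L r = geom-≤ L λ n → ≤-trans (m≤m+n _ _) (≤-reflexive (endings-telescope s (suc L) r n))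

-- The threshold lies below δ′(s).

γ-≥ : ∀ L s → 1 ≤ L → 41 ≤ prodShift L s → prodShift L s ^ 40 ≤ γ L s
γ-≥ (suc L) s _ 41≤P = begin
  P ^ 40               ≤⟨ ^-monoʳ-≤ P {{>-nonZero (≤-trans (s≤s z≤n) 41≤P)}} (begin
    -- One power of P in γ is enough; 40 is the exponent reached in `threshold-≤`.
    40                   ≤⟨ ∸-monoˡ-≤ 1 (*-mono-≤ 41≤P (≤-trans (s≤s (z≤n {40})) 41≤P)) ⟩
    P * P ∸ 1            ≤⟨ m≤m*n (P * P ∸ 1) (suc L) ⟩
    (P * P ∸ 1) * suc L  ≤⟨ m≤m+n _ 2 ⟩
    E                    ∎) ⟩
  P ^ E                ≤⟨ m≤m+n (P ^ E) _ ⟩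
  P ^ E + R            ≤⟨ m≤n*m (P ^ E + R) (sumShift (suc L) s) {{>-nonZero sumShift-pos}} ⟩
  γ (suc L) s          ∎
  where
  open ≤-Reasoning
  P = prodShift (suc L) s
  E = (P * P ∸ 1) * suc L + 2
  R = ((P * P ∸ 1) * suc L ∸ 2) * P
  sumShift-pos : 0 < sumShift (suc L) s
  sumShift-pos = ≤-trans (≤-trans (s≤s z≤n) (m≤n+m (suc L) s)) (m≤n+m (s + suc L) (sumShift L s))

prodShift-mono : ∀ j k s → prodShift k s ≤ prodShift (j + k) s
prodShift-mono zero    k s = ≤-refl
prodShift-mono (suc j) k s = ≤-trans (prodShift-mono j k s)
  (m≤m*n (prodShift (j + k) s) (s + suc (j + k)) {{>-nonZero (≤-trans (s≤s z≤n) (m≤n+m (suc (j + k)) s))}})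

-- Only five factors are kept: s + 1, and s + 2, ..., s + 5, which are at least 3, 4, 5, 6 with
-- product 360.
prodShift-≥ : ∀ L s → 5 ≤ L → 1 ≤ s → 360 * suc s ≤ prodShift L s
prodShift-≥ L s 5≤L 1≤s = begin
  360 * suc s                                              ≡⟨ lem (suc s) ⟩
  1 * suc s * 3 * 4 * 5 * 6
    ≤⟨ *-mono-≤ (*-mono-≤ (*-mono-≤ (*-mono-≤ (≤-reflexive (cong (1 *_) (+-comm 1 s)))
         (+-monoˡ-≤ 2 1≤s)) (+-monoˡ-≤ 3 1≤s)) (+-monoˡ-≤ 4 1≤s)) (+-monoˡ-≤ 5 1≤s) ⟩
  prodShift 5 s                                            ≤⟨ prodShift-mono (L ∸ 5) 5 s ⟩
  prodShift (L ∸ 5 + 5) s                                  ≡⟨ cong (λ L → prodShift L s) (m∸n+n≡m 5≤L) ⟩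
  prodShift L s                                            ∎
  where
  open ≤-Reasoning
  lem : ∀ a → 360 * a ≡ 1 * a * 3 * 4 * 5 * 6
  lem = solve-∀

-- The threshold is a polynomial in `a` and `b`, both at most `P`. Here `S` is the `sizeBound` in
-- use and `S * S` the `multBound`; `S` equals 648 a⁶ b, hence is at most `Q`, the eighth power of
-- `P`. The total is then at most 4Q⁴ ≤ Q⁵.
threshold-≤ : ∀ s P → 1 ≤ s → 360 * suc s ≤ P → threshold s ≤ P ^ 40
threshold-≤ s P 1≤s le = begin
  threshold s
    ≡⟨ cong₂ _+_ (cong₂ _+_ (cong (_* (S * (b + S))) (*-assoc S (2 * K₂) (a * b))) (eqM a b)) (*-assoc 3 a a) ⟩
  S * S * (S * (b + S)) + 18 * (a * (a * (a * b))) + 3 * (a * a)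
    ≤⟨ +-mono-≤ (+-mono-≤ (*-mono-≤ (*-mono-≤ S≤Q S≤Q) (*-mono-≤ S≤Q (+-mono-≤ b≤Q S≤Q))) e≤Q) f≤Q ⟩
  Q * Q * (Q * (Q + Q)) + Q + Q
    ≡⟨ eqQ Q ⟩
  2 * (Q * (Q * (Q * (Q * 1)))) + 2 * (Q * 1)
    ≤⟨ +-monoʳ-≤ (2 * Q ^ 4) (*-monoʳ-≤ 2 (^-monoʳ-≤ Q {{>-nonZero (small z<s)}} {1} {4} (s≤s z≤n))) ⟩
  2 * Q ^ 4 + 2 * Q ^ 4
    ≡⟨ *-distribʳ-+ (Q ^ 4) 2 2 ⟨
  4 * Q ^ 4
    ≤⟨ *-monoˡ-≤ (Q ^ 4) (small (s≤s (s≤s (s≤s (s≤s z≤n))))) ⟩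
  Q ^ 5
    ≡⟨ ^-*-assoc P 8 5 ⟩
  P ^ 40 ∎
  where
  open ≤-Reasoning
  a = suc s
  b = suc a
  K₂ = 2 * (3 * a * (3 * a)) * a * (2 * (3 * a * (3 * a)))
  S = 2 * K₂ * (a * b)
  Q = P ^ 8
  eqM : ∀ a b → 2 * (3 * a * (3 * a)) * a * b ≡ 18 * (a * (a * (a * b)))
  eqM = solve-∀
  eqS : ∀ a b → 2 * (2 * (3 * a * (3 * a)) * a * (2 * (3 * a * (3 * a)))) * (a * b)
    ≡ 648 * (a * (a * (a * (a * (a * (a * (b * 1)))))))
  eqS = solve-∀
  eqQ : ∀ Q → Q * Q * (Q * (Q + Q)) + Q + Q ≡ 2 * (Q * (Q * (Q * (Q * 1)))) + 2 * (Q * 1)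
  eqQ = solve-∀
  720≤P : 720 ≤ P
  720≤P = ≤-trans (*-monoʳ-≤ 360 (s≤s 1≤s)) le
  a≤P : a ≤ P
  a≤P = ≤-trans (m≤n*m a 360) le
  b≤P : b ≤ P
  b≤P = ≤-trans (+-mono-≤ (s≤s z≤n) (m≤n*m a 359)) le
  raise : ∀ i → i ≤ 8 → P ^ i ≤ Q
  raise i i≤8 = ^-monoʳ-≤ P {{>-nonZero (≤-trans (s≤s z≤n) 720≤P)}} i≤8
  P≤Q : P ≤ Q
  P≤Q = ≤-trans (≤-reflexive (sym (*-identityʳ P))) (raise 1 (m≤m+n 1 7))
  small : ∀ {i} → i ≤ 4 → i ≤ Q
  small i≤4 = ≤-trans i≤4 (≤-trans (m≤m+n 4 716) (≤-trans 720≤P P≤Q))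
  S≤Q : S ≤ Q
  S≤Q = ≤-trans (≤-reflexive (eqS a b)) (*-mono-≤ (≤-trans (m≤m+n 648 72) 720≤P)
    (*-mono-≤ a≤P (*-mono-≤ a≤P (*-mono-≤ a≤P (*-mono-≤ a≤P (*-mono-≤ a≤P (*-mono-≤ a≤P
      (*-monoˡ-≤ 1 b≤P))))))))
  b≤Q : b ≤ Q
  b≤Q = ≤-trans b≤P P≤Q
  e≤Q : 18 * (a * (a * (a * b))) ≤ Q
  e≤Q = ≤-trans (*-mono-≤ (≤-trans (m≤m+n 18 702) 720≤P) (*-mono-≤ a≤P (*-mono-≤ a≤P (*-mono-≤ a≤P
    (≤-trans b≤P (≤-reflexive (sym (*-identityʳ P)))))))) (raise 5 (m≤m+n 5 3))
  f≤Q : 3 * (a * a) ≤ Q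
  f≤Q = ≤-trans (*-mono-≤ (≤-trans (m≤m+n 3 717) 720≤P) (*-mono-≤ a≤P
    (≤-trans a≤P (≤-reflexive (sym (*-identityʳ P)))))) (raise 3 (m≤m+n 3 5))

Γ-≥ : ∀ s → 1 ≤ s → threshold s ≤ Γ s
Γ-≥ s 1≤s = ≤-trans (threshold-≤ s P 1≤s 360≤P) (γ-≥ L s (≤-trans (s≤s z≤n) 5≤L) (≤-trans 41≤ 360≤P))
  where
  L = 3 * s + 2
  P = prodShift L s
  5≤L : 5 ≤ L
  5≤L = +-monoˡ-≤ 2 (*-monoʳ-≤ 3 1≤s)
  360≤P = prodShift-≥ L s 5≤L 1≤s
  41≤ : 41 ≤ 360 * suc s
  41≤ = ≤-trans (m≤m+n 41 319) (*-monoʳ-≤ 360 (s≤s (z≤n {s})))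

above-δ′ : ∀ s n → 1 ≤ s → AboveDelta' s n → threshold s < n
above-δ′ s n 1≤s above = <-≤-trans (s≤s (Γ-≥ s 1≤s)) (begin
  1 + y                                              ≤⟨ +-monoʳ-≤ 1 (m≤n*m y 3) ⟩
  1 + 3 * y                                          ≡⟨ cong suc (*-identityʳ (3 * y)) ⟨
  1 * 1 + (3 * y) ^ 1                                ≤⟨ m≤n*m _ c {{>-nonZero c>0}} ⟩
  c * (1 * 1 + (3 * y) ^ 1)                          ≤⟨ m≤n+m _ (1 * (10 * s + c)) ⟩
  -- The truncation `K = 1`, that is e^y ≥ 1 + y, already suffices.
  1 * (10 * s + c) + c * (1 * 1 + (3 * y) ^ 1)       ≤⟨ above 1 ⟩
  1 * n                                              ≡⟨ *-identityˡ n ⟩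
  n                                                  ∎)
  where
  open ≤-Reasoning
  y = Γ s
  c = (s + 2) * (s + 3)
  c>0 : 0 < c
  c>0 = *-mono-≤ (≤-trans (s≤s z≤n) (m≤n+m 2 s)) (≤-trans (s≤s z≤n) (m≤n+m 3 s))

theorem4 : (L s n : ℕ) → 1 ≤ s → s + 1 ≤ L → AboveDelta' s n →
    (As Bs : List (List ℕ)) →
    Unique As → (∀ π → (π ∈ As) ⇔ PosPart L s n π) →
    Unique Bs → (∀ π → (π ∈ Bs) ⇔ NegPart L s n π) →
    length Bs < length As
theorem4 (suc L) (suc s) n 1≤s s<L above As Bs _ posIff uniq negIff = begin-strict
  length Bs
    ≤⟨ unique-⊆-length uniq (λ {π} h → NegPart⇒∈endings (suc L) (suc s) n (Equivalence.to (negIff π) h)) ⟩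
  length (endings (suc s) (suc (suc L)) n n)
    ≤⟨ endings-length (suc s) L n n ⟩
  geom L (seg (suc s) (suc L) δ) n
    <⟨ series-inequality s L n (s≤s⁻¹ (≤-trans (≤-reflexive (+-comm 1 (suc s))) s<L))
         (above-δ′ (suc s) n 1≤s above) ⟩
  sh (suc s) (geom s (seg (suc s) (suc L) δ)) n
    -- The factor of the smallest admissible part comes out, leaving the product that appears on the
    -- negative side.
    ≡⟨ sh-cong (suc s) (seg-front s (suc L) δ) n ⟨
  sh (suc s) (seg s (suc (suc L)) δ) n
    ≡⟨ ending-length s (suc (suc L)) n ⟨
  length (ending s (suc (suc L)) n)
    ≤⟨ unique-⊆-length (ending-unique s (suc (suc L)) n) (λ {π} h → Equivalence.from (posIff π)
         (IsEnding⇒PosPart s (suc L) n (All.lookup (ending-sound s (suc (suc L)) n) h))) ⟩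
  length As ∎
  where open ≤-Reasoning
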